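{- For every $L_2$ formula $\varphi(x,y)$ (possibly with set parameters), let $U_\varphi$ be $$\forall X\,\exists x\,\forall y\,(y\in X\leftrightarrow\varphi(x,y)),$$ and let $\Phi$ be the subformula closure of the formula $\exists X\,\forall y\,(y\in X\leftrightarrow\varphi(x,y))$. Then over $\mathsf{RCA}_0^*$ the reflection instance $\mathsf{Rfn}_\Phi$ refutes $U_\varphi$ (i.e. $\mathsf{RCA}_0^*+\mathsf{Rfn}_\Phi\vdash\neg U_\varphi$, for all values of the set parameters). Thus the reflection scheme $\mathsf{Rfn}$ fails in every uniformly enumerated model of $\mathsf{RCA}_0^*$; and for arithmetical $\varphi$ the refuting instance lies in $\Sigma^1_1\text{ - }\mathsf{Rfn}$.
   Context: $L_2$ is the two-sorted language of second-order arithmetic with $0,1,+,\cdot$ and a unary function symbol $\mathsf{exp}$ for base-two exponentiation. $\Sigma^1_n,\Pi^1_n$ formulas are prefixes of set quantifiers followed by a matrix without set quantifiers; arithmetical formulas have no set quantifiers. $\mathsf{RCA}_0^*$ is Robinson's $\mathsf{Q}$ with the recursive defining axioms of $\mathsf{exp}$, $\Delta^0_0$-induction and $\Delta^0_1$-comprehension (with parameters). Fix a monotone primitive recursive pairing bijection $\langle\cdot,\cdot\rangle$ on the naturals; the $i$-th section of $Y$ is $(Y)_i=\{m:\langle i,m\rangle\in Y\}$. Write $X\dot\in Y$ for $\exists z\,((Y)_z=X)$. $\varphi^Y$ is $\varphi$ with all set quantifiers relativized to the sections of $Y$. For an $L_2$ formula $\varphi(\vec P,\vec x,\vec X)$ with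 all free variables displayed, $\mathsf{Rfn}_\varphi$ is the sentence $$\forall\vec P\,\exists Y\,\Bigl(\vec P\dot\in Y\wedge\forall\vec x\,\forall\vec X\dot\in Y\,\bigl(\varphi(\vec P,\vec x,\vec X)\leftrightarrow\varphi^Y(\vec P,\vec x,\vec X)\bigr)\Bigr),$$ where $\vec P\dot\in Y$ means that each $P_i$ is a section of $Y$ and $\forall\vec X\dot\in Y$ ranges over tuples of sections of $Y$. For a finite set of formulas $\Phi=\{\varphi_i(\vec P,\vec x_i,\vec X_i):i<k\}$, $\mathsf{Rfn}_\Phi$ is the simultaneous statement: for all $\vec P$ there is one $Y$ with $\vec P\dot\in Y$ such that $\forall\vec x_i\,\forall\vec X_i\dot\in Y\,(\varphi_i\leftrightarrow\varphi_i^Y)$ for every $i<k$. (Here $\vec P$ consists of the set parameters of the given formula.) $\Sigma^1_n\text{ - }\mathsf{Rfn}$ is the scheme of all $\mathsf{Rfn}_\varphi$ for $\varphi$ in $\Sigma^1_n\cup\Pi^1_n$; simultaneous instances $\mathsf{Rfn}_\Phi$ for finite $\Phi\subseteq\Sigma^1_n\cup\Pi^1_n$ (formulas being taken up to provable equivalence) follow from single instances and are counted as belonging to this scheme. $\mathsf{Rfn}$ is the scheme of all $\mathsf{Rfn}_\varphi$, $\varphi$ any $L_2$ formula. A model $(M,\mathcal{S})$ of $\mathsf{RCA}_0^*$ is uniformly enumerated if $U_\varphi$ holds in it for some $L_2$ formula $\varphi(x,y)$, possibly with set parameters from $\mathcal{S}$. -}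

module Defs where

open import Level using (Level; 0ℓ)
import Level
open import Data.Nat using (ℕ; zero; suc; _+_)
open import Data.Fin using (Fin; zero; suc; _↑ʳ_; lift)
open import Data.List using (List; []; _∷_; [_]; _++_; map; foldr; allFin)
open import Data.List.Membership.Propositional using (_∈_)
open import Data.List.Relation.Unary.All using (All)
open import Data.Vec.Functional using (Vector) renaming (_∷_ to _◂_; [] to ∅)
open import Data.Product using (_×_; Σ-syntax; ∃-syntax)
open import Data.Sum using (_⊎_)
import Data.Empty.Polymorphic as Empty
import Relation.Nullary as Meta
open import Relation.Unary using (Pred)
open import Relation.Binary.PropositionalEquality using (_≡_)
open import Function using (id; _∘_)

infixl 7 _⊗_
infixl 6 _⊕_
infix  5 _≐_ _ε_ _<_ _∈̇_
infix  4 ¬_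
infixr 3 _∧_
infixr 2 _∨_
infixr 1 _⇒_
infix  0 _⇔_

-- De Bruijn indices, one numbering per sort: Formula s n has s free set
-- variables and n free number variables, index zero being the innermost.

data Term (n : ℕ) : Set where
  var     : Fin n → Term n
  𝟎 𝟏     : Term n
  _⊕_ _⊗_ : Term n → Term n → Term n
  exp     : Term n → Term n

data Formula (s n : ℕ) : Set where
  ⊥           : Formula s n
  _≐_         : Term n → Term n → Formula s n
  _ε_         : Term n → Fin s → Formula s n
  _∧_ _∨_ _⇒_ : Formula s n → Formula s n → Formula s n
  ∀⁰ ∃⁰       : Formula s (suc n) → Formula s n
  ∀¹ ∃¹       : Formula (suc s) n → Formula s n

Sentence : Set
Sentence = Formula 0 0

Theory : Set₁
Theory = Pred Sentence 0ℓ

pattern x₀ = var zero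
pattern x₁ = var (suc zero)

private variable
  s s′ n n′ k p : ℕ

⊤ : Formula s n
⊤ = ⊥ ⇒ ⊥

¬_ : Formula s n → Formula s n
¬ φ = φ ⇒ ⊥

_⇔_ : Formula s n → Formula s n → Formula s n
φ ⇔ ψ = (φ ⇒ ψ) ∧ (ψ ⇒ φ)

⋀ : List (Formula s n) → Formula s n
⋀ = foldr _∧_ ⊤

∀⁰s : ∀ n → Formula s n → Formula s 0
∀⁰s zero    φ = φ
∀⁰s (suc n) φ = ∀⁰s n (∀⁰ φ)

∀¹s : ∀ s → Formula s n → Formula 0 n
∀¹s zero    φ = φ
∀¹s (suc s) φ = ∀¹s s (∀¹ φ)

closure : Formula s n → Sentence
closure {s} {n} φ = ∀¹s s (∀⁰s n φ)

-- Simultaneous substitution: terms for number variables, and variables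
-- for set variables (L₂ has no other set terms).

subᵗ : (Fin n → Term n′) → Term n → Term n′
subᵗ σ (var i) = σ i
subᵗ σ 𝟎       = 𝟎
subᵗ σ 𝟏       = 𝟏
subᵗ σ (t ⊕ u) = subᵗ σ t ⊕ subᵗ σ u
subᵗ σ (t ⊗ u) = subᵗ σ t ⊗ subᵗ σ u
subᵗ σ (exp t) = exp (subᵗ σ t)

wkᵗ : Term n → Term (suc n)
wkᵗ = subᵗ (var ∘ suc)

liftˢ : (Fin n → Term n′) → Fin (suc n) → Term (suc n′)
liftˢ σ zero    = x₀
liftˢ σ (suc i) = wkᵗ (σ i)

sub : (Fin s → Fin s′) → (Fin n → Term n′) → Formula s n → Formula s′ n′
sub ρ σ ⊥       = ⊥
sub ρ σ (t ≐ u) = subᵗ σ t ≐ subᵗ σ u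
sub ρ σ (t ε X) = subᵗ σ t ε ρ X
sub ρ σ (φ ∧ ψ) = sub ρ σ φ ∧ sub ρ σ ψ
sub ρ σ (φ ∨ ψ) = sub ρ σ φ ∨ sub ρ σ ψ
sub ρ σ (φ ⇒ ψ) = sub ρ σ φ ⇒ sub ρ σ ψ
sub ρ σ (∀⁰ φ)  = ∀⁰ (sub ρ (liftˢ σ) φ)
sub ρ σ (∃⁰ φ)  = ∃⁰ (sub ρ (liftˢ σ) φ)
sub ρ σ (∀¹ φ)  = ∀¹ (sub (lift 1 ρ) σ φ)
sub ρ σ (∃¹ φ)  = ∃¹ (sub (lift 1 ρ) σ φ)

renSet : (Fin s → Fin s′) → Formula s n → Formula s′ n
renSet ρ = sub ρ var

wk⁰ : Formula s n → Formula s (suc n)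
wk⁰ = sub id (var ∘ suc)

wk¹ : Formula s n → Formula (suc s) n
wk¹ = renSet suc

embed : Sentence → Formula s n
embed = sub (λ ()) (λ ())

_[_]⁰ : Formula s (suc n) → Term n → Formula s n
φ [ t ]⁰ = sub id (t ◂ var) φ

_[_]¹ : Formula (suc s) n → Fin s → Formula s n
φ [ X ]¹ = renSet (X ◂ id) φ

private variable
  φ ψ χ : Formula s n
  Γ     : List (Formula s n)
  t u   : Term n

-- Classical logic. Only numbers have a primitive equality; sets are compared
-- by their elements.

infix -1 _∣_⊢_ _⊢_

data _∣_⊢_ (T : Theory) : List (Formula s n) → Formula s n → Set where
  axiom   : ∀ {σ} → T σ → T ∣ Γ ⊢ embed σ
  hyp     : φ ∈ Γ → T ∣ Γ ⊢ φ
  raa     : T ∣ (¬ φ) ∷ Γ ⊢ ⊥ → T ∣ Γ ⊢ φ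
  ∧-intro : T ∣ Γ ⊢ φ → T ∣ Γ ⊢ ψ → T ∣ Γ ⊢ φ ∧ ψ
  ∧-elim₁ : T ∣ Γ ⊢ φ ∧ ψ → T ∣ Γ ⊢ φ
  ∧-elim₂ : T ∣ Γ ⊢ φ ∧ ψ → T ∣ Γ ⊢ ψ
  ∨-intro₁ : T ∣ Γ ⊢ φ → T ∣ Γ ⊢ φ ∨ ψ
  ∨-intro₂ : T ∣ Γ ⊢ ψ → T ∣ Γ ⊢ φ ∨ ψ
  ∨-elim  : T ∣ Γ ⊢ φ ∨ ψ → T ∣ φ ∷ Γ ⊢ χ → T ∣ ψ ∷ Γ ⊢ χ → T ∣ Γ ⊢ χ
  ⇒-intro : T ∣ φ ∷ Γ ⊢ ψ → T ∣ Γ ⊢ φ ⇒ ψ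
  ⇒-elim  : T ∣ Γ ⊢ φ ⇒ ψ → T ∣ Γ ⊢ φ → T ∣ Γ ⊢ ψ
  ∀⁰-intro : T ∣ map wk⁰ Γ ⊢ φ → T ∣ Γ ⊢ ∀⁰ φ
  ∀⁰-elim : T ∣ Γ ⊢ ∀⁰ φ → ∀ t → T ∣ Γ ⊢ φ [ t ]⁰
  ∃⁰-intro : ∀ t → T ∣ Γ ⊢ φ [ t ]⁰ → T ∣ Γ ⊢ ∃⁰ φ
  ∃⁰-elim : T ∣ Γ ⊢ ∃⁰ φ → T ∣ φ ∷ map wk⁰ Γ ⊢ wk⁰ ψ → T ∣ Γ ⊢ ψ
  ∀¹-intro : T ∣ map wk¹ Γ ⊢ φ → T ∣ Γ ⊢ ∀¹ φ
  ∀¹-elim : T ∣ Γ ⊢ ∀¹ φ → ∀ X → T ∣ Γ ⊢ φ [ X ]¹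
  ∃¹-intro : ∀ X → T ∣ Γ ⊢ φ [ X ]¹ → T ∣ Γ ⊢ ∃¹ φ
  ∃¹-elim : T ∣ Γ ⊢ ∃¹ φ → T ∣ φ ∷ map wk¹ Γ ⊢ wk¹ ψ → T ∣ Γ ⊢ ψ
  ≐-refl  : T ∣ Γ ⊢ t ≐ t
  ≐-subst : ∀ φ → T ∣ Γ ⊢ t ≐ u → T ∣ Γ ⊢ φ [ t ]⁰ → T ∣ Γ ⊢ φ [ u ]⁰

_⊢_ : Theory → Sentence → Set
T ⊢ σ = T ∣ [] ⊢ σ

_<_ : Term n → Term n → Formula s n
t < u = ∃⁰ (wkᵗ t ⊕ (x₀ ⊕ 𝟏) ≐ wkᵗ u)

∀[<_] ∃[<_] : Term n → Formula s (suc n) → Formula s n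
∀[< t ] φ = ∀⁰ (x₀ < wkᵗ t ⇒ φ)
∃[< t ] φ = ∃⁰ (x₀ < wkᵗ t ∧ φ)

-- exp may occur in the bounds.

data Δ⁰₀ : Formula s n → Set where
  ⊥    : Δ⁰₀ {s} {n} ⊥
  _≐_  : ∀ (t u : Term n) → Δ⁰₀ {s} (t ≐ u)
  _ε_  : ∀ (t : Term n) (X : Fin s) → Δ⁰₀ (t ε X)
  _∧_  : Δ⁰₀ φ → Δ⁰₀ ψ → Δ⁰₀ (φ ∧ ψ)
  _∨_  : Δ⁰₀ φ → Δ⁰₀ ψ → Δ⁰₀ (φ ∨ ψ)
  _⇒_  : Δ⁰₀ φ → Δ⁰₀ ψ → Δ⁰₀ (φ ⇒ ψ)
  ∀[<] : ∀ t → Δ⁰₀ φ → Δ⁰₀ (∀[< t ] φ)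
  ∃[<] : ∀ t → Δ⁰₀ φ → Δ⁰₀ (∃[< t ] φ)

-- Quantifier blocks may be empty here and below, so the classes are
-- cumulative.

data Σ⁰₁ : Formula s n → Set where
  Δ⁰₀⊆Σ⁰₁ : Δ⁰₀ φ → Σ⁰₁ φ
  ∃⁰      : Σ⁰₁ φ → Σ⁰₁ (∃⁰ φ)

data Π⁰₁ : Formula s n → Set where
  Δ⁰₀⊆Π⁰₁ : Δ⁰₀ φ → Π⁰₁ φ
  ∀⁰      : Π⁰₁ φ → Π⁰₁ (∀⁰ φ)

data Arithmetical : Formula s n → Set where
  ⊥   : Arithmetical {s} {n} ⊥
  _≐_ : ∀ (t u : Term n) → Arithmetical {s} (t ≐ u)
  _ε_ : ∀ (t : Term n) (X : Fin s) → Arithmetical (t ε X)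
  _∧_ : Arithmetical φ → Arithmetical ψ → Arithmetical (φ ∧ ψ)
  _∨_ : Arithmetical φ → Arithmetical ψ → Arithmetical (φ ∨ ψ)
  _⇒_ : Arithmetical φ → Arithmetical ψ → Arithmetical (φ ⇒ ψ)
  ∀⁰  : Arithmetical φ → Arithmetical (∀⁰ φ)
  ∃⁰  : Arithmetical φ → Arithmetical (∃⁰ φ)

mutual
  data Σ¹ : ℕ → Formula s n → Set where
    arithmetical : Arithmetical φ → Σ¹ k φ
    Π¹⊆Σ¹        : Π¹ k φ → Σ¹ (suc k) φ
    ∃¹           : Σ¹ (suc k) φ → Σ¹ (suc k) (∃¹ φ)

  data Π¹ : ℕ → Formula s n → Set where
    arithmetical : Arithmetical φ → Π¹ k φ
    Σ¹⊆Π¹        : Σ¹ k φ → Π¹ (suc k) φ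
    ∀¹           : Π¹ (suc k) φ → Π¹ (suc k) (∀¹ φ)

data RCA₀* : Theory where
  Q-suc≢0   : RCA₀* (∀⁰ (¬ (x₀ ⊕ 𝟏 ≐ 𝟎)))
  Q-suc-inj : RCA₀* (∀⁰ (∀⁰ (x₁ ⊕ 𝟏 ≐ x₀ ⊕ 𝟏 ⇒ x₁ ≐ x₀)))
  Q-pred    : RCA₀* (∀⁰ ((¬ (x₀ ≐ 𝟎)) ⇒ ∃⁰ (x₁ ≐ x₀ ⊕ 𝟏)))
  Q-+-zero  : RCA₀* (∀⁰ (x₀ ⊕ 𝟎 ≐ x₀))
  Q-+-suc   : RCA₀* (∀⁰ (∀⁰ (x₁ ⊕ (x₀ ⊕ 𝟏) ≐ (x₁ ⊕ x₀) ⊕ 𝟏)))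
  Q-*-zero  : RCA₀* (∀⁰ (x₀ ⊗ 𝟎 ≐ 𝟎))
  Q-*-suc   : RCA₀* (∀⁰ (∀⁰ (x₁ ⊗ (x₀ ⊕ 𝟏) ≐ x₁ ⊗ x₀ ⊕ x₁)))
  exp-zero  : RCA₀* (exp 𝟎 ≐ 𝟏)
  exp-suc   : RCA₀* (∀⁰ (exp (x₀ ⊕ 𝟏) ≐ (𝟏 ⊕ 𝟏) ⊗ exp x₀))
  Δ⁰₀-induction : ∀ (φ : Formula s (suc n)) → Δ⁰₀ φ →
    RCA₀* (closure (φ [ 𝟎 ]⁰
                    ∧ ∀⁰ (φ ⇒ sub id ((x₀ ⊕ 𝟏) ◂ (var ∘ suc)) φ)
                    ⇒ ∀⁰ φ))
  Δ⁰₁-comprehension : ∀ (φ ψ : Formula s (suc n)) → Σ⁰₁ φ → Π⁰₁ ψ →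
    RCA₀* (closure (∀⁰ (φ ⇔ ψ) ⇒ ∃¹ (∀⁰ (x₀ ε zero ⇔ wk¹ φ))))

-- ⟨ i , m ⟩ = (i + m)(i + m + 1) / 2 + m (Cantor's pairing); dividing by 2
-- is avoided by working with 2 ⟨ i , m ⟩, which also serves as a bound.

2⟨_,_⟩ : Term n → Term n → Term n
2⟨ i , m ⟩ = (i ⊕ m) ⊗ ((i ⊕ m) ⊕ 𝟏) ⊕ (m ⊕ m)

⟨_,_⟩ε_ : Term n → Term n → Fin s → Formula s n
⟨ i , m ⟩ε Y = ∃[< 2⟨ i , m ⟩ ⊕ 𝟏 ] (x₀ ⊕ x₀ ≐ wkᵗ 2⟨ i , m ⟩ ∧ x₀ ε Y)

_∈̇_ : Fin s → Fin s → Formula s n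
X ∈̇ Y = ∃⁰ (∀⁰ (⟨ x₁ , x₀ ⟩ε Y ⇔ x₀ ε X))

∀∈̇ ∃∈̇ : Fin s → Formula (suc s) n → Formula s n
∀∈̇ Y φ = ∀¹ (zero ∈̇ suc Y ⇒ φ)
∃∈̇ Y φ = ∃¹ (zero ∈̇ suc Y ∧ φ)

∀∈̇s : ∀ k → Fin s → Formula (k + s) n → Formula s n
∀∈̇s zero    Y φ = φ
∀∈̇s (suc k) Y φ = ∀∈̇s k Y (∀∈̇ (k ↑ʳ Y) φ)

_^_ : Formula s n → Fin s → Formula s n
⊥       ^ Y = ⊥
(t ≐ u) ^ Y = t ≐ u
(t ε X) ^ Y = t ε X
(φ ∧ ψ) ^ Y = (φ ^ Y) ∧ (ψ ^ Y)
(φ ∨ ψ) ^ Y = (φ ^ Y) ∨ (ψ ^ Y)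
(φ ⇒ ψ) ^ Y = (φ ^ Y) ⇒ (ψ ^ Y)
∀⁰ φ    ^ Y = ∀⁰ (φ ^ Y)
∃⁰ φ    ^ Y = ∃⁰ (φ ^ Y)
∀¹ φ    ^ Y = ∀∈̇ Y (φ ^ suc Y)
∃¹ φ    ^ Y = ∃∈̇ Y (φ ^ suc Y)

-- φ(P⃗ , x⃗ , X⃗) with p parameters P⃗; the set variables X⃗ come first in the
-- de Bruijn numbering, as they do when they are bound around a subformula
-- of a formula in P⃗.

record Over (p : ℕ) : Set where
  constructor over
  field
    sets    : ℕ
    numbers : ℕ
    formula : Formula (sets + p) numbers

-- The parameters P⃗ are the variables suc i, and Y is the variable zero.

reflects : Over p → Formula (suc p) 0
reflects {p} (over k n φ) =
  ∀⁰s n (∀∈̇s k zero (φ′ ⇔ φ′ ^ (k ↑ʳ zero)))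
  where
  φ′ : Formula (k + suc p) n
  φ′ = renSet (lift k suc) φ

Rfn : List (Over p) → Sentence
Rfn {p} Φ =
  ∀¹s p (∃¹ (⋀ (map (λ i → suc i ∈̇ zero) (allFin p)) ∧ ⋀ (map reflects Φ)))

data RfnScheme : Theory where
  instance-of : ∀ (φ : Over p) → RfnScheme (Rfn [ φ ])

data Σ¹-Rfn (k : ℕ) : Theory where
  instance-of : ∀ (Φ : List (Over p)) →
    All (λ φ → Σ¹ k (Over.formula φ) ⊎ Π¹ k (Over.formula φ)) Φ →
    Σ¹-Rfn k (Rfn Φ)

-- k counts the enclosing set quantifiers. A subformula keeps all of their
-- variables in scope, also those not occurring in it; in Rfn these only give
-- vacuous quantifiers over sections of Y (which exist in RCA₀*).

subformulas : ∀ k → Formula (k + p) n → List (Over p)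
subformulas k φ = over k _ φ ∷ proper k φ
  where
  proper : ∀ {p n} k → Formula (k + p) n → List (Over p)
  proper k ⊥       = []
  proper k (t ≐ u) = []
  proper k (t ε X) = []
  proper k (φ ∧ ψ) = subformulas k φ ++ subformulas k ψ
  proper k (φ ∨ ψ) = subformulas k φ ++ subformulas k ψ
  proper k (φ ⇒ ψ) = subformulas k φ ++ subformulas k ψ
  proper k (∀⁰ φ)  = subformulas k φ
  proper k (∃⁰ φ)  = subformulas k φ
  proper k (∀¹ φ)  = subformulas (suc k) φ
  proper k (∃¹ φ)  = subformulas (suc k) φ

-- In φ(x , y) the variable y is x₀ and x is x₁.

enumerates : Formula p 2 → Formula (suc p) 1
enumerates φ = ∀⁰ (x₀ ε zero ⇔ wk¹ φ)

U : Formula p 2 → Formula p 0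
U φ = ∀¹ (∃⁰ (enumerates φ))

Φ : Formula p 2 → List (Over p)
Φ φ = subformulas 0 (∃¹ (enumerates φ))

-- (M , 𝒮), with 𝒮 the family of sets {a | a ∈ᴹ A}. Satisfaction is read with
-- Agda's own connectives; excluded middle for it is not required of a
-- structure, so classical structures are among those considered.

record Structure (ℓ : Level) : Set (Level.suc ℓ) where
  field
    Num   : Set ℓ
    Sets  : Set ℓ
    0ᴹ 1ᴹ : Num
    _+ᴹ_  : Num → Num → Num
    _*ᴹ_  : Num → Num → Num
    expᴹ  : Num → Num
    _∈ᴹ_  : Num → Sets → Set ℓ

  ⟦_⟧ : Term n → Vector Num n → Num
  ⟦ var i ⟧ e = e i
  ⟦ 𝟎 ⟧     e = 0ᴹ
  ⟦ 𝟏 ⟧     e = 1ᴹ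
  ⟦ t ⊕ u ⟧ e = ⟦ t ⟧ e +ᴹ ⟦ u ⟧ e
  ⟦ t ⊗ u ⟧ e = ⟦ t ⟧ e *ᴹ ⟦ u ⟧ e
  ⟦ exp t ⟧ e = expᴹ (⟦ t ⟧ e)

  Sat : Vector Sets s → Vector Num n → Formula s n → Set ℓ
  Sat E e ⊥       = Empty.⊥
  Sat E e (t ≐ u) = ⟦ t ⟧ e ≡ ⟦ u ⟧ e
  Sat E e (t ε X) = ⟦ t ⟧ e ∈ᴹ E X
  Sat E e (φ ∧ ψ) = Sat E e φ × Sat E e ψ
  Sat E e (φ ∨ ψ) = Sat E e φ ⊎ Sat E e ψ
  Sat E e (φ ⇒ ψ) = Sat E e φ → Sat E e ψ
  Sat E e (∀⁰ φ)  = ∀ a → Sat E (a ◂ e) φ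
  Sat E e (∃⁰ φ)  = ∃[ a ] Sat E (a ◂ e) φ
  Sat E e (∀¹ φ)  = ∀ A → Sat (A ◂ E) e φ
  Sat E e (∃¹ φ)  = ∃[ A ] Sat (A ◂ E) e φ

  Holds : Sentence → Set ℓ
  Holds = Sat ∅ ∅

_⊨_ : ∀ {ℓ} → Structure ℓ → Theory → Set ℓ
M ⊨ T = ∀ σ → T σ → Structure.Holds M σ

_FailsIn_ : ∀ {ℓ} → Theory → Structure ℓ → Set ℓ
T FailsIn M = ∃[ σ ] T σ × Meta.¬ Structure.Holds M σ

UniformlyEnumerated : ∀ {ℓ} → Structure ℓ → Set ℓ
UniformlyEnumerated M =
  ∃[ p ] Σ[ φ ∈ Formula p 2 ] Σ[ P ∈ Vector Sets p ] Sat P ∅ (U φ)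
  where open Structure M

{-# OPTIONS --safe #-}
module Submission where

-- Under U every set D is enumerated by some x, so θ(x) = ∃X ∀y (y ∈ X ↔ φ(x , y))
-- holds. Reflecting θ gives a section X of Y with θ's matrix relativized to Y,
-- and reflecting the matrix shows that X is enumerated by x as well; hence D = X.
-- So every set is a section of Y, which is refuted by D = {i : ⟨ i , i ⟩ ∉ Y},
-- a set by comprehension for a Δ⁰₀ formula.

open import Defs
open import Level using (Level)
open import Data.Nat using (ℕ; zero; suc; _+_)
open import Data.Fin using (Fin; zero; suc; lift)
open import Data.List using (List; []; _∷_; map; allFin)
open import Data.List.Relation.Unary.All using (All; []; _∷_)
open import Data.List.Relation.Unary.All.Properties using (++⁺)
open import Data.List.Relation.Unary.Any using (here; there)
open import Data.Vec.Functional using (Vector; head; tail) renaming (_∷_ to _◂_; [] to ∅)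
open import Data.Product using (_×_; _,_; proj₁; proj₂; ∃-syntax)
open import Data.Product.Function.NonDependent.Propositional using (_×-⇔_)
open import Data.Sum using (_⊎_; inj₁; inj₂)
open import Data.Sum.Function.Propositional using (_⊎-⇔_)
import Data.Empty.Polymorphic as Empty
open import Function using (id; _∘_; mk⇔; Equivalence) renaming (_⇔_ to _⟺_)
open import Function.Related.TypeIsomorphisms using (→-cong-⇔)
open import Relation.Binary.PropositionalEquality
  using (_≡_; _≗_; refl; sym; trans; cong; cong₂; subst)
open import Relation.Unary using (_∪_; ｛_｝; _⊆_)

private variable
  s s′ s″ n n′ n″ p : ℕ
  ℓ : Level
  T : Theory

-- Substitution

subᵗ-id : {σ : Fin n → Term n} → σ ≗ var → ∀ t → subᵗ σ t ≡ t
subᵗ-id eq (var i) = eq i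
subᵗ-id eq 𝟎       = refl
subᵗ-id eq 𝟏       = refl
subᵗ-id eq (t ⊕ u) = cong₂ _⊕_ (subᵗ-id eq t) (subᵗ-id eq u)
subᵗ-id eq (t ⊗ u) = cong₂ _⊗_ (subᵗ-id eq t) (subᵗ-id eq u)
subᵗ-id eq (exp t) = cong exp (subᵗ-id eq t)

subᵗ-subᵗ : {σ : Fin n′ → Term n″} {τ : Fin n → Term n′} {υ : Fin n → Term n″} →
  subᵗ σ ∘ τ ≗ υ → subᵗ σ ∘ subᵗ τ ≗ subᵗ υ
subᵗ-subᵗ eq (var i) = eq i
subᵗ-subᵗ eq 𝟎       = refl
subᵗ-subᵗ eq 𝟏       = refl
subᵗ-subᵗ eq (t ⊕ u) = cong₂ _⊕_ (subᵗ-subᵗ eq t) (subᵗ-subᵗ eq u)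
subᵗ-subᵗ eq (t ⊗ u) = cong₂ _⊗_ (subᵗ-subᵗ eq t) (subᵗ-subᵗ eq u)
subᵗ-subᵗ eq (exp t) = cong exp (subᵗ-subᵗ eq t)

lift-id : {ρ : Fin s → Fin s} → ρ ≗ id → lift 1 ρ ≗ id
lift-id eq zero    = refl
lift-id eq (suc i) = cong suc (eq i)

lift-lift : {ρ : Fin s′ → Fin s″} {π : Fin s → Fin s′} {θ : Fin s → Fin s″} →
  ρ ∘ π ≗ θ → lift 1 ρ ∘ lift 1 π ≗ lift 1 θ
lift-lift eq zero    = refl
lift-lift eq (suc i) = cong suc (eq i)

liftˢ-id : {σ : Fin n → Term n} → σ ≗ var → liftˢ σ ≗ var
liftˢ-id eq zero    = refl
liftˢ-id eq (suc i) = cong wkᵗ (eq i)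

-- In the successor case both sides reduce to substituting `wkᵗ ∘ σ` in `τ i`.
liftˢ-liftˢ : {σ : Fin n′ → Term n″} {τ : Fin n → Term n′} {υ : Fin n → Term n″} →
  subᵗ σ ∘ τ ≗ υ → subᵗ (liftˢ σ) ∘ liftˢ τ ≗ liftˢ υ
liftˢ-liftˢ eq zero = refl
liftˢ-liftˢ {σ = σ} {τ} eq (suc i) =
  trans (subᵗ-subᵗ (λ _ → refl) (τ i))
    (trans (sym (subᵗ-subᵗ (λ _ → refl) (τ i))) (cong wkᵗ (eq i)))

sub-id : {ρ : Fin s → Fin s} {σ : Fin n → Term n} → ρ ≗ id → σ ≗ var →
  ∀ φ → sub ρ σ φ ≡ φ
sub-id e f ⊥       = refl
sub-id e f (t ≐ u) = cong₂ _≐_ (subᵗ-id f t) (subᵗ-id f u)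
sub-id e f (t ε X) = cong₂ _ε_ (subᵗ-id f t) (e X)
sub-id e f (φ ∧ ψ) = cong₂ _∧_ (sub-id e f φ) (sub-id e f ψ)
sub-id e f (φ ∨ ψ) = cong₂ _∨_ (sub-id e f φ) (sub-id e f ψ)
sub-id e f (φ ⇒ ψ) = cong₂ _⇒_ (sub-id e f φ) (sub-id e f ψ)
sub-id e f (∀⁰ φ)  = cong ∀⁰ (sub-id e (liftˢ-id f) φ)
sub-id e f (∃⁰ φ)  = cong ∃⁰ (sub-id e (liftˢ-id f) φ)
sub-id e f (∀¹ φ)  = cong ∀¹ (sub-id (lift-id e) f φ)
sub-id e f (∃¹ φ)  = cong ∃¹ (sub-id (lift-id e) f φ)

-- The composite is an argument of its own, required to agree only pointwise: this passes under
-- binders without function extensionality, and each use may name the composite in the form it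
-- needs.
sub-sub : {ρ : Fin s′ → Fin s″} {π : Fin s → Fin s′} {θ : Fin s → Fin s″}
  {σ : Fin n′ → Term n″} {τ : Fin n → Term n′} {υ : Fin n → Term n″} →
  ρ ∘ π ≗ θ → subᵗ σ ∘ τ ≗ υ → ∀ φ → sub ρ σ (sub π τ φ) ≡ sub θ υ φ
sub-sub e f ⊥       = refl
sub-sub e f (t ≐ u) = cong₂ _≐_ (subᵗ-subᵗ f t) (subᵗ-subᵗ f u)
sub-sub e f (t ε X) = cong₂ _ε_ (subᵗ-subᵗ f t) (e X)
sub-sub e f (φ ∧ ψ) = cong₂ _∧_ (sub-sub e f φ) (sub-sub e f ψ)
sub-sub e f (φ ∨ ψ) = cong₂ _∨_ (sub-sub e f φ) (sub-sub e f ψ)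
sub-sub e f (φ ⇒ ψ) = cong₂ _⇒_ (sub-sub e f φ) (sub-sub e f ψ)
sub-sub e f (∀⁰ φ)  = cong ∀⁰ (sub-sub e (liftˢ-liftˢ f) φ)
sub-sub e f (∃⁰ φ)  = cong ∃⁰ (sub-sub e (liftˢ-liftˢ f) φ)
sub-sub e f (∀¹ φ)  = cong ∀¹ (sub-sub (lift-lift e) f φ)
sub-sub e f (∃¹ φ)  = cong ∃¹ (sub-sub (lift-lift e) f φ)

sub-cong : {ρ π : Fin s → Fin s′} {σ τ : Fin n → Term n′} → ρ ≗ π → σ ≗ τ →
  ∀ φ → sub ρ σ φ ≡ sub π τ φ
sub-cong e f φ =
  trans (cong (sub _ _) (sym (sub-id (λ _ → refl) (λ _ → refl) φ))) (sub-sub e f φ)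

-- A guard `zero ∈̇ suc Y` has no free number variables, so substitution passes through it by
-- computation and only the body needs the induction.
sub-^ : (ρ : Fin s → Fin s′) (σ : Fin n → Term n′) (Y : Fin s) →
  ∀ φ → sub ρ σ (φ ^ Y) ≡ sub ρ σ φ ^ ρ Y
sub-^ ρ σ Y ⊥       = refl
sub-^ ρ σ Y (t ≐ u) = refl
sub-^ ρ σ Y (t ε X) = refl
sub-^ ρ σ Y (φ ∧ ψ) = cong₂ _∧_ (sub-^ ρ σ Y φ) (sub-^ ρ σ Y ψ)
sub-^ ρ σ Y (φ ∨ ψ) = cong₂ _∨_ (sub-^ ρ σ Y φ) (sub-^ ρ σ Y ψ)
sub-^ ρ σ Y (φ ⇒ ψ) = cong₂ _⇒_ (sub-^ ρ σ Y φ) (sub-^ ρ σ Y ψ)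
sub-^ ρ σ Y (∀⁰ φ)  = cong ∀⁰ (sub-^ ρ (liftˢ σ) Y φ)
sub-^ ρ σ Y (∃⁰ φ)  = cong ∃⁰ (sub-^ ρ (liftˢ σ) Y φ)
sub-^ ρ σ Y (∀¹ φ)  = cong (λ χ → ∀¹ (zero ∈̇ suc (ρ Y) ⇒ χ)) (sub-^ (lift 1 ρ) σ (suc Y) φ)
sub-^ ρ σ Y (∃¹ φ)  = cong (λ χ → ∃¹ (zero ∈̇ suc (ρ Y) ∧ χ)) (sub-^ (lift 1 ρ) σ (suc Y) φ)

-- The diagonal set

diagonal : Fin s → Formula s (suc n)
diagonal Y = ¬ (⟨ x₀ , x₀ ⟩ε Y)

Δ⁰₀-diagonal : (Y : Fin s) → Δ⁰₀ {s} {suc n} (diagonal Y)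
Δ⁰₀-diagonal Y = ∃[<] (2⟨ x₀ , x₀ ⟩ ⊕ 𝟏) ((_ ≐ _) ∧ (_ ε _)) ⇒ ⊥

-- The same Δ⁰₀ formula stands on both sides, so the premise of comprehension is a tautology.
diagonal-comprehension : Sentence
diagonal-comprehension =
  closure {1} {0} (∀⁰ (diagonal zero ⇔ diagonal zero)
                   ⇒ ∃¹ (∀⁰ (x₀ ε zero ⇔ wk¹ (diagonal zero))))

RCA₀*-diagonal : RCA₀* diagonal-comprehension
RCA₀*-diagonal = Δ⁰₁-comprehension {s = 1} {n = 0} (diagonal zero) (diagonal zero)
  (Δ⁰₀⊆Σ⁰₁ (Δ⁰₀-diagonal zero)) (Δ⁰₀⊆Π⁰₁ (Δ⁰₀-diagonal zero))

-- Derivations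

private variable
  Γ     : List (Formula s n)
  φ ψ χ : Formula s n

convert : φ ≡ ψ → T ∣ Γ ⊢ φ → T ∣ Γ ⊢ ψ
convert = subst (_ ∣ _ ⊢_)

pattern #0 = hyp (here refl)
pattern #1 = hyp (there (here refl))
pattern #2 = hyp (there (there (here refl)))
pattern #3 = hyp (there (there (there (here refl))))

∀¹s-intro : ∀ p {φ : Formula p 0} → T ∣ [] ⊢ φ → T ⊢ ∀¹s p φ
∀¹s-intro zero    d = d
∀¹s-intro (suc p) d = ∀¹s-intro p (∀¹-intro d)

sub-wk¹-zero : (φ : Formula (suc s) n) → sub (lift 1 suc) var φ [ zero ]¹ ≡ φ
sub-wk¹-zero φ = trans
  (sub-sub (λ { zero → refl ; (suc _) → refl }) (λ _ → refl) φ)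
  (sub-id (λ _ → refl) (λ _ → refl) φ)

∀¹-distrib-⇒ : ∀ {φ ψ : Formula (suc s) n} →
  T ∣ Γ ⊢ ∀¹ (φ ⇒ ψ) ⇒ (∀¹ φ ⇒ ∀¹ ψ)
∀¹-distrib-⇒ {φ = φ} {ψ} = ⇒-intro (⇒-intro (∀¹-intro (⇒-elim
  (convert (sub-wk¹-zero (φ ⇒ ψ)) (∀¹-elim #1 zero))
  (convert (sub-wk¹-zero φ) (∀¹-elim #0 zero)))))

-- `∀¹s` peels off the innermost quantifier, so `∀¹-distrib-⇒` is needed under the remaining block,
-- where the induction hypothesis applies it.
∀¹s-mp : ∀ p {φ ψ : Formula p 0} →
  T ⊢ ∀¹s p (φ ⇒ ψ) → T ⊢ ∀¹s p φ → T ⊢ ∀¹s p ψ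
∀¹s-mp zero    d e = ⇒-elim d e
∀¹s-mp (suc p) d e =
  ∀¹s-mp p (∀¹s-mp p (∀¹s-intro p ∀¹-distrib-⇒) d) e

module _ {ρ : Fin s → Fin s′} {σ : Fin n → Term n′} {Γ : List (Formula s′ n′)} where

  private
    instantiate⁰ : ∀ φ t → sub ρ (liftˢ σ) φ [ t ]⁰ ≡ sub ρ (t ◂ σ) φ
    instantiate⁰ φ t = sub-sub (λ _ → refl)
      (λ { zero    → refl
         ; (suc i) → trans (subᵗ-subᵗ (λ _ → refl) (σ i)) (subᵗ-id (λ _ → refl) (σ i)) }) φ

    instantiate¹ : ∀ φ X → sub (lift 1 ρ) σ φ [ X ]¹ ≡ sub (X ◂ ρ) σ φ
    instantiate¹ φ X = sub-sub (λ { zero → refl ; (suc _) → refl })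
      (λ i → subᵗ-id (λ _ → refl) (σ i)) φ

  -- Instantiation is absorbed into the ambient substitution, so a formula whose quantifiers are
  -- removed one by one remains a single substitution instance of its matrix.
  ∀⁰-inst : ∀ φ t → T ∣ Γ ⊢ sub ρ σ (∀⁰ φ) → T ∣ Γ ⊢ sub ρ (t ◂ σ) φ
  ∀⁰-inst φ t d = convert (instantiate⁰ φ t) (∀⁰-elim d t)

  ∀¹-inst : ∀ φ X → T ∣ Γ ⊢ sub ρ σ (∀¹ φ) → T ∣ Γ ⊢ sub (X ◂ ρ) σ φ
  ∀¹-inst φ X d = convert (instantiate¹ φ X) (∀¹-elim d X)

  ∃¹-inst : ∀ φ X → T ∣ Γ ⊢ sub (X ◂ ρ) σ φ → T ∣ Γ ⊢ sub ρ σ (∃¹ φ)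
  ∃¹-inst φ X d = ∃¹-intro X (convert (sym (instantiate¹ φ X)) d)

-- The implication is derived first and then applied to `d` and `e`, which thus stay in `Γ` and need
-- no weakening.
⇒-trans : T ∣ Γ ⊢ φ ⇒ ψ → T ∣ Γ ⊢ ψ ⇒ χ → T ∣ Γ ⊢ φ ⇒ χ
⇒-trans d e = ⇒-elim (⇒-elim
  (⇒-intro (⇒-intro (⇒-intro (⇒-elim #1 (⇒-elim #2 #0))))) d) e

⇔-trans : T ∣ Γ ⊢ φ ⇔ ψ → T ∣ Γ ⊢ ψ ⇔ χ → T ∣ Γ ⊢ φ ⇔ χ
⇔-trans d e = ∧-intro (⇒-trans (∧-elim₁ d) (∧-elim₁ e)) (⇒-trans (∧-elim₂ e) (∧-elim₂ d))

⇔-sym : T ∣ Γ ⊢ φ ⇔ ψ → T ∣ Γ ⊢ ψ ⇔ φ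
⇔-sym d = ∧-intro (∧-elim₂ d) (∧-elim₁ d)

⇔¬-absurd : T ∣ Γ ⊢ φ ⇔ ¬ φ → T ∣ Γ ⊢ ⊥
⇔¬-absurd d = ⇒-elim (⇒-elim (∧-elim₁ d) a) a
  -- `φ ⇒ ¬ φ` contracts to `¬ φ`, from which the converse half gives `φ`.
  where a = ⇒-elim (∧-elim₂ d) (⇒-elim (⇒-intro
              (⇒-intro (⇒-elim (⇒-elim #1 #0) #0))) (∧-elim₁ d))

-- Diagonalization against the sections of a set

diagonal-exists : RCA₀* ⊆ T → (Y : Fin s) → {Γ : List (Formula s n)} →
  T ∣ Γ ⊢ ∃¹ (∀⁰ (x₀ ε zero ⇔ diagonal (suc Y)))
diagonal-exists ax Y = ⇒-elim (∀¹-elim (axiom (ax RCA₀*-diagonal)) Y)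
  (∀⁰-intro (∧-intro (⇒-intro #0) (⇒-intro #0)))

-- Cantor's argument: if `D` is the z-th section, then at z both ⟨z,z⟩ ∈ Y ⇔ z ∈ D and z ∈ D ⇔ ⟨z,z⟩
-- ∉ Y hold.
diagonal-not-section : {D Y : Fin s} {Γ : List (Formula s n)} →
  T ∣ Γ ⊢ ∀⁰ (x₀ ε D ⇔ diagonal Y) ⇒ ¬ (D ∈̇ Y)
diagonal-not-section = ⇒-intro (⇒-intro (∃⁰-elim #0 (⇔¬-absurd
  (⇔-trans (∀⁰-elim #0 x₀) (∀⁰-elim #2 x₀)))))

-- Sets have no primitive equality; a common definition `χ` takes its place, and the index of `X`
-- serves for `D`.
section-resp-⇔ : {X D Y : Fin s} {χ : Formula s (suc n)} →
  T ∣ Γ ⊢ ∀⁰ (x₀ ε X ⇔ χ) ⇒ (∀⁰ (x₀ ε D ⇔ χ) ⇒ (X ∈̇ Y ⇒ D ∈̇ Y))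
section-resp-⇔ = ⇒-intro (⇒-intro (⇒-intro (∃⁰-elim #0 (∃⁰-intro x₀ (∀⁰-intro
  (⇔-trans (∀⁰-elim #0 x₀)
    (⇔-trans (∀⁰-elim #3 x₀) (⇔-sym (∀⁰-elim #2 x₀)))))))))

-- `ρ` and `π` differ only at the enumerated set, so `wk¹ φ` has the same instance under both and
-- serves as `χ`.
section-resp-enumerates : {ρ π : Fin (suc p) → Fin s} {σ : Fin 1 → Term n}
  {Γ : List (Formula s n)} {Y : Fin s} (φ : Formula p 2) → ρ ∘ suc ≗ π ∘ suc →
  T ∣ Γ ⊢ sub ρ σ (enumerates φ) → T ∣ Γ ⊢ sub π σ (enumerates φ) →
  T ∣ Γ ⊢ ρ zero ∈̇ Y → T ∣ Γ ⊢ π zero ∈̇ Y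
section-resp-enumerates {ρ = ρ} {π} {σ} φ eq d e = ⇒-elim (⇒-elim (⇒-elim section-resp-⇔
  (convert (cong (λ χ → ∀⁰ (x₀ ε ρ zero ⇔ χ)) same) d)) e)
  where
  same : sub ρ (liftˢ σ) (wk¹ φ) ≡ sub π (liftˢ σ) (wk¹ φ)
  same = trans (sub-sub eq (λ _ → refl) φ) (sym (sub-sub (λ _ → refl) (λ _ → refl) φ))

-- Refutation of `U` by a derivation from reflection

module _ {T : Theory} (ax : RCA₀* ⊆ T) {p} (φ : Formula p 2) where

  private
    E : Formula (suc p) 1
    E = enumerates φ

    -- `F` and `H` are θ and its matrix with a variable for `Y` inserted, as `reflects` renames
    -- them.
    F : Formula (suc p) 1
    F = wk¹ (∃¹ E)

    H : Formula (suc (suc p)) 1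
    H = renSet (lift 1 suc) E

    -- The matrices of reflects for the first two elements of Φ φ, which are
    -- ∃¹ E and E.
    r₁ : Formula (suc p) 1
    r₁ = F ⇔ F ^ zero

    r₂ : Formula (suc (suc p)) 1
    r₂ = zero ∈̇ suc zero ⇒ (H ⇔ H ^ suc zero)

    reflected : Formula (suc p) 0
    reflected = ⋀ (map (λ i → suc i ∈̇ zero) (allFin p)) ∧ ⋀ (map reflects (Φ φ))

    diagonalᴰ : Formula (suc (suc p)) 0
    diagonalᴰ = ∀⁰ (x₀ ε zero ⇔ diagonal (suc zero))

    shift : Fin s → Fin (suc (suc s))
    shift i = suc (suc i)

    ξ : Fin 1 → Term 1
    ξ = x₀ ◂ λ ()

    Eᴰ : Formula (suc (suc p)) 1
    Eᴰ = sub (zero ◂ shift) (liftˢ var) E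

  -- The set variables are D, Y, P⃗ and the number variable is x; the ∃¹-elim
  -- puts the section X in front of them.
  contradiction-in-scope : {Γ : List (Formula (suc (suc p)) 1)} →
    T ∣ Eᴰ ∷ wk⁰ diagonalᴰ ∷ wk⁰ (wk¹ reflected) ∷ Γ ⊢ ⊥
  contradiction-in-scope = ∃¹-elim exists-section
    (⇒-elim (⇒-elim diagonal-not-section #2)
      (section-resp-enumerates {ρ = zero ◂ (shift ∘ suc)} {suc ∘ (zero ◂ shift)} {ξ}
        φ (λ _ → refl) X-enumerated D-enumerated (∧-elim₁ #0)))
    where
    exists-section : T ∣ _ ⊢ sub suc ξ (F ^ zero)
    exists-section = ⇒-elim
      (∧-elim₁ (∀⁰-inst {ρ = suc} {λ ()} r₁ x₀
        (convert (sub-sub (λ _ → refl) (λ ()) (∀⁰ r₁)) (∧-elim₁ (∧-elim₂ #2)))))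
      -- Here `zero` is still `D`, the witness for θ(x).
      (convert (sym (sub-sub (λ _ → refl) (λ { zero → refl }) (∃¹ E)))
        (∃¹-inst {ρ = shift} {ξ} E zero
          (convert (sub-cong (λ _ → refl) (λ { zero → refl }) E) #0)))

    X-enumerated : T ∣ _ ⊢ sub (zero ◂ (shift ∘ suc)) ξ E
    X-enumerated = convert
      (sub-sub (λ { zero → refl ; (suc _) → refl }) (λ { zero → refl }) E)
      (⇒-elim
        -- The matrix is reflected downwards: from its relativization, known for the section `X`, to
        -- its true form.
        (∧-elim₂ (⇒-elim
          (∀¹-inst {ρ = shift} {ξ} r₂ zero
            (∀⁰-inst {ρ = shift} {λ ()} (∀¹ r₂) x₀
              (convert
                (trans
                  -- The hypothesis was weakened for `D`, x and `X` in turn; the three weakenings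
                  -- collapse to `shift`.
                  (cong wk¹ (sub-sub {υ = λ ()} (λ _ → refl) (λ ()) (∀⁰ (∀¹ r₂))))
                  (sub-sub (λ _ → refl) (λ ()) (∀⁰ (∀¹ r₂))))
                (∧-elim₁ (∧-elim₂ (∧-elim₂ #3))))))
          (∧-elim₁ #0)))
        (convert (sub-cong (λ { zero → refl ; (suc _) → refl }) (λ _ → refl) (H ^ suc zero))
          (∧-elim₂ #0)))

    D-enumerated : T ∣ _ ⊢ sub (suc ∘ (zero ◂ shift)) ξ E
    D-enumerated = convert (sub-sub (λ _ → refl) (λ { zero → refl }) E) #1

  reflection-refutes-U : T ⊢ ∀¹s p (∃¹ reflected ⇒ ¬ U φ)
  reflection-refutes-U = ∀¹s-intro p (⇒-intro (⇒-intro (∃¹-elim #1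
    (∃¹-elim (diagonal-exists ax zero) (∃⁰-elim
      (∀¹-inst {ρ = shift} {var} (∃⁰ E) zero
        (convert (sub-sub (λ _ → refl) (λ _ → refl) (U φ)) #2))
      contradiction-in-scope)))))

Rfn-refutes-U : (φ : Formula p 2) → RCA₀* ∪ ｛ Rfn (Φ φ) ｝ ⊢ ∀¹s p (¬ U φ)
Rfn-refutes-U {p} φ = ∀¹s-mp p (reflection-refutes-U inj₁ φ)
  (convert (sub-id (λ ()) (λ ()) (Rfn (Φ φ))) (axiom (inj₂ refl)))

-- Satisfaction

module Semantics (M : Structure ℓ) where

  open Structure M

  ⟦⟧-sub : {σ : Fin n → Term n′} {e′ : Vector Num n′} {e : Vector Num n} →
    (∀ i → ⟦ σ i ⟧ e′ ≡ e i) → ∀ t → ⟦ subᵗ σ t ⟧ e′ ≡ ⟦ t ⟧ e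
  ⟦⟧-sub f (var i) = f i
  ⟦⟧-sub f 𝟎       = refl
  ⟦⟧-sub f 𝟏       = refl
  ⟦⟧-sub f (t ⊕ u) = cong₂ _+ᴹ_ (⟦⟧-sub f t) (⟦⟧-sub f u)
  ⟦⟧-sub f (t ⊗ u) = cong₂ _*ᴹ_ (⟦⟧-sub f t) (⟦⟧-sub f u)
  ⟦⟧-sub f (exp t) = cong expᴹ (⟦⟧-sub f t)

  private
    ≡⇒⟺ : {A B : Set ℓ} → A ≡ B → A ⟺ B
    ≡⇒⟺ refl = mk⇔ id id

    ∀-cong : {A : Set ℓ} {B C : A → Set ℓ} → (∀ a → B a ⟺ C a) → (∀ a → B a) ⟺ (∀ a → C a)
    ∀-cong f = mk⇔ (λ b a → to (f a) (b a)) (λ c a → from (f a) (c a))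
      where open Equivalence

    ∃-cong : {A : Set ℓ} {B C : A → Set ℓ} → (∀ a → B a ⟺ C a) → (∃[ a ] B a) ⟺ (∃[ a ] C a)
    ∃-cong f = mk⇔ (λ (a , b) → a , to (f a) b) (λ (a , c) → a , from (f a) c)
      where open Equivalence

    ◂-sub : {σ : Fin n → Term n′} {e′ : Vector Num n′} {e : Vector Num n} →
      (∀ i → ⟦ σ i ⟧ e′ ≡ e i) → ∀ a i → ⟦ liftˢ σ i ⟧ (a ◂ e′) ≡ (a ◂ e) i
    ◂-sub f a zero            = refl
    ◂-sub {σ = σ} f a (suc i) = trans (⟦⟧-sub (λ _ → refl) (σ i)) (f i)

    ◂-lift : {ρ : Fin s → Fin s′} {E′ : Vector Sets s′} {E : Vector Sets s} →
      E′ ∘ ρ ≗ E → ∀ A → (A ◂ E′) ∘ lift 1 ρ ≗ A ◂ E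
    ◂-lift g A zero    = refl
    ◂-lift g A (suc i) = g i

  -- The environments agree only pointwise, so the quantifier cases yield equivalences and not
  -- equalities of types.
  Sat-sub : {ρ : Fin s → Fin s′} {σ : Fin n → Term n′}
    {E′ : Vector Sets s′} {e′ : Vector Num n′} {E : Vector Sets s} {e : Vector Num n} →
    E′ ∘ ρ ≗ E → (∀ i → ⟦ σ i ⟧ e′ ≡ e i) →
    ∀ φ → Sat E′ e′ (sub ρ σ φ) ⟺ Sat E e φ
  Sat-sub g f ⊥       = mk⇔ id id
  Sat-sub g f (t ≐ u) = ≡⇒⟺ (cong₂ _≡_ (⟦⟧-sub f t) (⟦⟧-sub f u))
  Sat-sub g f (t ε X) = ≡⇒⟺ (cong₂ _∈ᴹ_ (⟦⟧-sub f t) (g X))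
  Sat-sub g f (φ ∧ ψ) = Sat-sub g f φ ×-⇔ Sat-sub g f ψ
  Sat-sub g f (φ ∨ ψ) = Sat-sub g f φ ⊎-⇔ Sat-sub g f ψ
  Sat-sub g f (φ ⇒ ψ) = →-cong-⇔ (Sat-sub g f φ) (Sat-sub g f ψ)
  Sat-sub g f (∀⁰ φ)  = ∀-cong λ a → Sat-sub g (◂-sub f a) φ
  Sat-sub g f (∃⁰ φ)  = ∃-cong λ a → Sat-sub g (◂-sub f a) φ
  Sat-sub g f (∀¹ φ)  = ∀-cong λ A → Sat-sub (◂-lift g A) f φ
  Sat-sub g f (∃¹ φ)  = ∃-cong λ A → Sat-sub (◂-lift g A) f φ

  Sat-cong : {E E′ : Vector Sets s} {e : Vector Num n} → E ≗ E′ →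
    ∀ φ → Sat E e φ → Sat E′ e φ
  Sat-cong eq φ = Equivalence.to (Sat-sub eq (λ _ → refl) φ)
    ∘ subst (Sat _ _) (sym (sub-id (λ _ → refl) (λ _ → refl) φ))

  Sat-∀¹s : ∀ s {e : Vector Num n} {φ : Formula s n} →
    Sat ∅ e (∀¹s s φ) → ∀ E → Sat E e φ
  Sat-∀¹s zero {φ = φ} h E = Sat-cong (λ ()) φ h
  Sat-∀¹s (suc s) {φ = φ} h E =
    Sat-cong (λ { zero → refl ; (suc _) → refl }) φ (Sat-∀¹s s h (tail E) (head E))

  -- Y need not be among the variables of φ, so it is adjoined to them on the right.
  Sat-^ : {ρ : Fin s → Fin s′} {σ : Fin n → Term n′}
    {E′ : Vector Sets s′} {e′ : Vector Num n′} {E : Vector Sets s} {e : Vector Num n} →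
    ∀ Y → E′ ∘ ρ ≗ E → (∀ i → ⟦ σ i ⟧ e′ ≡ e i) →
    ∀ φ → Sat E′ e′ (sub ρ σ φ ^ Y) ⟺ Sat (E′ Y ◂ E) e (wk¹ φ ^ zero)
  Sat-^ {ρ = ρ} {σ} {E′} {e′} Y g f φ =
    subst (λ χ → Sat E′ e′ χ ⟺ _)
      (trans (sub-^ (Y ◂ ρ) σ zero (wk¹ φ))
        (cong (_^ Y) (sub-sub (λ _ → refl) (λ _ → refl) φ)))
      (Sat-sub (λ { zero → refl ; (suc i) → g i }) f (wk¹ φ ^ zero))

-- The scheme has one formula per instance; taking n = 0 and n ≠ 0 in this one
-- reflects θ and φ simultaneously. The number variables are n, y, x, in this order.
combined : Formula p 2 → Formula p 3
combined φ =
  (x₀ ≐ 𝟎 ∧ sub id (λ _ → var (suc (suc zero))) (∃¹ (enumerates φ)))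
  ∨ ((¬ (x₀ ≐ 𝟎)) ∧ wk⁰ φ)

-- The argument is repeated in the model instead of transferred by soundness: `raa` would call for
-- excluded middle for satisfaction, which a structure need not have.
Rfn-fails : (M : Structure ℓ) → M ⊨ RCA₀* → UniformlyEnumerated M → RfnScheme FailsIn M
Rfn-fails {ℓ} M rca (p , φ , P , u) = Rfn (instance′ ∷ []) , instance-of instance′ , λ rfn →
  let Y , _ , r , _ = Sat-∀¹s p rfn P
      D , d         = rca _ RCA₀*-diagonal Y (λ _ → id , id)
      x , enum      = u D
  in Empty.⊥-elim (no-reflection Y r D d x enum)
  where
  open Structure M
  open Semantics M
  open Equivalence

  instance′ : Over p
  instance′ = over 0 3 (combined φ)

  θ-terms : Fin 1 → Term 3
  θ-terms _ = var (suc (suc zero))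

  -- The nonzero value of the selector n. `Q-suc≢0` speaks of successors, hence 0 + 1 and not 1.
  0+1≢0 : 0ᴹ +ᴹ 1ᴹ ≡ 0ᴹ → Empty.⊥ {ℓ}
  0+1≢0 = rca _ Q-suc≢0 0ᴹ

  no-reflection : ∀ Y → Sat (Y ◂ P) ∅ (reflects instance′) →
    ∀ D → Sat (D ◂ Y ◂ ∅) ∅ (∀⁰ (x₀ ε zero ⇔ diagonal (suc zero))) →
    ∀ x → Sat (D ◂ P) (x ◂ ∅) (enumerates φ) → Empty.⊥ {ℓ}
  no-reflection Y r D d x enum
    -- The arguments are x, y, n. With n = 0 the disjunct containing θ is chosen; y does not occur
    -- in it and defaults to 0.
    with proj₁ (r x 0ᴹ 0ᴹ) (inj₁ (refl ,
           from (Sat-sub (λ _ → refl) (λ _ → refl) (sub id θ-terms (∃¹ (enumerates φ))))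
             (from (Sat-sub (λ _ → refl) (λ { zero → refl }) (∃¹ (enumerates φ))) (D , enum))))
  ... | inj₂ (0≢0 , _) = 0≢0 refl
  -- `z` is the index of `X` in `Y`. Since ⟨z,z⟩ ∉ Y, `z` lies in `D`, hence in `X`, which puts
  -- ⟨z,z⟩ into `Y`.
  ... | inj₁ (_ , X , (z , section) , enumʸ) = ¬z∈Yz (proj₂ (section z) (D⊆X (proj₂ (d z) ¬z∈Yz)))
    where
    φʸ : Num → Set ℓ
    φʸ y = Sat (Y ◂ P) (y ◂ x ◂ ∅) (wk¹ φ ^ zero)

    -- Here φ is reflected in place of the matrix of θ: it has no set variables beyond the
    -- parameters, so it shares an instance with θ. At n = 0 + 1 the first disjunct is refuted on
    -- both sides of the reflected equivalence.
    φ⟺φʸ : ∀ y → Sat P (y ◂ x ◂ ∅) φ ⟺ φʸ y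
    φ⟺φʸ y = mk⇔ relativize unrelativize
      where
      φ-sat : Sat (Y ◂ P) (0ᴹ +ᴹ 1ᴹ ◂ y ◂ x ◂ ∅) (sub (lift 0 suc) var (wk⁰ φ))
        ⟺ Sat P (y ◂ x ◂ ∅) φ
      φ-sat = subst (λ χ → Sat (Y ◂ P) (0ᴹ +ᴹ 1ᴹ ◂ y ◂ x ◂ ∅) χ ⟺ Sat P (y ◂ x ◂ ∅) φ)
        (sym (sub-sub (λ _ → refl) (λ _ → refl) φ))
        (Sat-sub (λ _ → refl) (λ { zero → refl ; (suc zero) → refl }) φ)

      φʸ-sat : Sat (Y ◂ P) (0ᴹ +ᴹ 1ᴹ ◂ y ◂ x ◂ ∅) (sub (lift 0 suc) var (wk⁰ φ) ^ zero) ⟺ φʸ y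
      φʸ-sat = subst (λ χ → Sat (Y ◂ P) (0ᴹ +ᴹ 1ᴹ ◂ y ◂ x ◂ ∅) (χ ^ zero) ⟺ φʸ y)
        (sym (sub-sub (λ _ → refl) (λ _ → refl) φ))
        (Sat-^ zero (λ _ → refl) (λ { zero → refl ; (suc zero) → refl }) φ)

      relativize : Sat P (y ◂ x ◂ ∅) φ → φʸ y
      relativize h with proj₁ (r x y (0ᴹ +ᴹ 1ᴹ)) (inj₂ (0+1≢0 , from φ-sat h))
      ... | inj₁ (eq , _) = Empty.⊥-elim (0+1≢0 eq)
      ... | inj₂ (_ , h′) = to φʸ-sat h′

      unrelativize : φʸ y → Sat P (y ◂ x ◂ ∅) φ
      unrelativize h with proj₂ (r x y (0ᴹ +ᴹ 1ᴹ)) (inj₂ (0+1≢0 , from φʸ-sat h))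
      ... | inj₁ (eq , _) = Empty.⊥-elim (0+1≢0 eq)
      ... | inj₂ (_ , h′) = to φ-sat h′

    D⟺φ : ∀ y → Sat (D ◂ P) (y ◂ x ◂ ∅) (wk¹ φ) ⟺ Sat P (y ◂ x ◂ ∅) φ
    D⟺φ y = Sat-sub (λ _ → refl) (λ _ → refl) φ

    -- In the relativized matrix the copy of φ sits under the binder of `X`; `Sat-^` brings it back
    -- to `φʸ`.
    X⟺φʸ : ∀ y → Sat (X ◂ Y ◂ P) (y ◂ 0ᴹ ◂ 0ᴹ ◂ x ◂ ∅)
      (sub (lift 1 (lift 0 suc)) (liftˢ var) (sub (lift 1 id) (liftˢ θ-terms) (wk¹ φ)) ^ suc zero)
      ⟺ φʸ y
    X⟺φʸ y = subst (λ χ → Sat (X ◂ Y ◂ P) (y ◂ 0ᴹ ◂ 0ᴹ ◂ x ◂ ∅) (χ ^ suc zero) ⟺ φʸ y)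
      (sym (trans
        (cong (sub _ _) (sub-sub (λ _ → refl) (λ _ → refl) φ))
        (sub-sub (λ _ → refl) (λ _ → refl) φ)))
      (Sat-^ (suc zero) (λ _ → refl) (λ { zero → refl ; (suc zero) → refl }) φ)

    D⊆X : ∀ {y} → y ∈ᴹ D → y ∈ᴹ X
    D⊆X {y} h = proj₂ (enumʸ y) (from (X⟺φʸ y)
      (to (φ⟺φʸ y) (to (D⟺φ y) (proj₁ (enum y) h))))

    X⊆D : ∀ {y} → y ∈ᴹ X → y ∈ᴹ D
    X⊆D {y} h = proj₂ (enum y) (from (D⟺φ y)
      (from (φ⟺φʸ y) (to (X⟺φʸ y) (proj₁ (enumʸ y) h))))

    ¬z∈Yz : Sat (Y ◂ ∅) (z ◂ ∅) (diagonal zero)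
    ¬z∈Yz h = proj₁ (d z) (X⊆D (proj₁ (section z) h)) h

-- Complexity of the instance for arithmetical φ

Σ¹-or-Π¹ : Over p → Set
Σ¹-or-Π¹ φ = Σ¹ 1 (Over.formula φ) ⊎ Π¹ 1 (Over.formula φ)

arithmetical-sub : {ρ : Fin s → Fin s′} {σ : Fin n → Term n′} {φ : Formula s n} →
  Arithmetical φ → Arithmetical (sub ρ σ φ)
arithmetical-sub ⊥       = ⊥
arithmetical-sub (t ≐ u) = _ ≐ _
arithmetical-sub (t ε X) = _ ε _
arithmetical-sub (a ∧ b) = arithmetical-sub a ∧ arithmetical-sub b
arithmetical-sub (a ∨ b) = arithmetical-sub a ∨ arithmetical-sub b
arithmetical-sub (a ⇒ b) = arithmetical-sub a ⇒ arithmetical-sub b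
arithmetical-sub (∀⁰ a)  = ∀⁰ (arithmetical-sub a)
arithmetical-sub (∃⁰ a)  = ∃⁰ (arithmetical-sub a)

arithmetical-subformulas : ∀ k {φ : Formula (k + p) n} →
  Arithmetical φ → All Σ¹-or-Π¹ (subformulas k φ)
arithmetical-subformulas k a@⊥       = inj₁ (arithmetical a) ∷ []
arithmetical-subformulas k a@(t ≐ u) = inj₁ (arithmetical a) ∷ []
arithmetical-subformulas k a@(t ε X) = inj₁ (arithmetical a) ∷ []
arithmetical-subformulas k a@(b ∧ c) = inj₁ (arithmetical a) ∷
  ++⁺ (arithmetical-subformulas k b) (arithmetical-subformulas k c)
arithmetical-subformulas k a@(b ∨ c) = inj₁ (arithmetical a) ∷
  ++⁺ (arithmetical-subformulas k b) (arithmetical-subformulas k c)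
arithmetical-subformulas k a@(b ⇒ c) = inj₁ (arithmetical a) ∷
  ++⁺ (arithmetical-subformulas k b) (arithmetical-subformulas k c)
arithmetical-subformulas k a@(∀⁰ b)  = inj₁ (arithmetical a) ∷ arithmetical-subformulas k b
arithmetical-subformulas k a@(∃⁰ b)  = inj₁ (arithmetical a) ∷ arithmetical-subformulas k b

-- Only the head of the list, θ itself, has a set quantifier; all its proper subformulas are
-- arithmetical.
Σ¹-Rfn-Φ : (φ : Formula p 2) → Arithmetical φ → Σ¹-Rfn 1 (Rfn (Φ φ))
Σ¹-Rfn-Φ φ a = instance-of (Φ φ)
  (inj₁ (∃¹ (arithmetical enum)) ∷ arithmetical-subformulas 1 enum)
  where
  enum : Arithmetical (enumerates φ)
  enum = ∀⁰ (((_ ε _) ⇒ arithmetical-sub a) ∧ (arithmetical-sub a ⇒ (_ ε _)))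

theorem6p1 : ∀ {ℓ} →
    (∀ {p} (φ : Formula p 2) → RCA₀* ∪ ｛ Rfn (Φ φ) ｝ ⊢ ∀¹s p (¬ U φ))
    × (∀ (M : Structure ℓ) → M ⊨ RCA₀* → UniformlyEnumerated M → RfnScheme FailsIn M)
    × (∀ {p} (φ : Formula p 2) → Arithmetical φ → Σ¹-Rfn 1 (Rfn (Φ φ)))
theorem6p1 = Rfn-refutes-U , Rfn-fails , Σ¹-Rfn-Φ
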